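{- Let $\mathcal{E}$ be the class of Kalmár elementary functions. Then $$\langle 2x,\ x\bmod y,\ 2^x\rangle\subsetneqq\mathcal{E}.$$
   Context: $\mathbb{N}$ is the set of non-negative integers. An ($r$-ary, $r\ge 1$) operation on $\mathbb{N}$ is a function $\mathbb{N}^r\to\mathbb{N}$. Truncated subtraction is $x \mathbin{\dot- } y:=\max(x-y,0)$. Conventions: $\lfloor x/0\rfloor:=0$, and $x\bmod y:=x \mathbin{\dot- } y\lfloor x/y\rfloor$, so that $x\bmod 0=x$. A set $S$ of operations on $\mathbb{N}$ is closed under substitution if, whenever $f\in S$ is $r$-ary and $g_1,\dots,g_r\in S$ are $n$-ary, the operation $\vec x\mapsto f(g_1(\vec x),\dots,g_r(\vec x))$ is in $S$. For a set $\mathcal{B}$ of operations on $\mathbb{N}$, $\langle\mathcal{B}\rangle$ denotes the closure under substitution of $\mathcal{B}\cup C\cup P$, where $C$ is the set of all constant operations on $\mathbb{N}$ (of every arity) and $P$ is the set of all projections $(x_1,\dots,x_n)\mapsto x_i$. Here $2x$ and $2^x$ denote unary operations and $x\bmod y$ a binary operation. The Kalmár elementary functions, forming the class $\mathcal{E}$, are the elements of the smallest set of operations on $\mathbb{N}$ that contains the constants, the projections, the addition, and the truncated subtraction, and that is closed under substitution, bounded summation ($(\vec x,y)\mapsto\sum_{z<y}f(\vec x,z)$), and bounded multiplication ($(\vec x,y)\mapsto\prod_{z<y}f(\vec x,z)$). -}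

module Defs where

open import Data.Fin using (Fin)
open import Data.List using (sum; product; map; upTo)
open import Data.Nat using (ℕ; zero; suc; _+_; _*_; _∸_; _^_; _/_)
open import Data.Product using (_,_; ∃-syntax)
open import Data.Vec using (Vec; lookup; tabulate; head; tail; init; last; _∷ʳ_)
open import Level using (0ℓ)
open import Relation.Binary.PropositionalEquality using (_≗_)
open import Relation.Unary using (Pred; _∈_)

-- Since arities are at least 1, the pair (r , f) is an operation of arity suc r.
Operation : Set
Operation = ∃[ r ] (Vec ℕ (suc r) → ℕ)

unary : (ℕ → ℕ) → Operation
unary f = 0 , λ xs → f (head xs)

binary : (ℕ → ℕ → ℕ) → Operation
binary f = 1 , λ xs → f (head xs) (head (tail xs))

⌊_÷_⌋ : ℕ → ℕ → ℕ
⌊ x ÷ zero  ⌋ = 0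
⌊ x ÷ suc y ⌋ = x / suc y

-- Total on ℕ, with x mod 0 ≡ x, whereas the library's _%_ needs a non-zero divisor.
_mod_ : ℕ → ℕ → ℕ
x mod y = x ∸ y * ⌊ x ÷ y ⌋

substitute : ∀ {r n} → (Vec ℕ (suc r) → ℕ) → (Fin (suc r) → Vec ℕ (suc n) → ℕ) →
             Vec ℕ (suc n) → ℕ
substitute f g xs = f (tabulate λ i → g i xs)

-- The bound y is the last argument: (x⃗ , y) ↦ Σ_{z<y} f(x⃗ , z), where x⃗ may be empty.
boundedSum : ∀ {r} → (Vec ℕ (suc r) → ℕ) → Vec ℕ (suc r) → ℕ
boundedSum f xs = sum (map (λ z → f (init xs ∷ʳ z)) (upTo (last xs)))

boundedProduct : ∀ {r} → (Vec ℕ (suc r) → ℕ) → Vec ℕ (suc r) → ℕ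
boundedProduct f xs = product (map (λ z → f (init xs ∷ʳ z)) (upTo (last xs)))

-- The constructors `extensional` below make membership respect pointwise
-- equality, which is equality of operations in the absence of function
-- extensionality.

data ⟨_⟩ (B : Pred Operation 0ℓ) : Pred Operation 0ℓ where
  base         : ∀ {f} → f ∈ B → f ∈ ⟨ B ⟩
  constant     : ∀ {n} (c : ℕ) → (n , λ _ → c) ∈ ⟨ B ⟩
  projection   : ∀ {n} (i : Fin (suc n)) → (n , λ xs → lookup xs i) ∈ ⟨ B ⟩
  substitution : ∀ {r n f} {g : Fin (suc r) → Vec ℕ (suc n) → ℕ} →
                 (r , f) ∈ ⟨ B ⟩ → (∀ i → (n , g i) ∈ ⟨ B ⟩) →
                 (n , substitute f g) ∈ ⟨ B ⟩
  extensional  : ∀ {n} {f g : Vec ℕ (suc n) → ℕ} → f ≗ g →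
                 (n , f) ∈ ⟨ B ⟩ → (n , g) ∈ ⟨ B ⟩

data 𝓔 : Pred Operation 0ℓ where
  constant       : ∀ {n} (c : ℕ) → (n , λ _ → c) ∈ 𝓔
  projection     : ∀ {n} (i : Fin (suc n)) → (n , λ xs → lookup xs i) ∈ 𝓔
  addition       : binary _+_ ∈ 𝓔
  subtraction    : binary _∸_ ∈ 𝓔
  substitution   : ∀ {r n f} {g : Fin (suc r) → Vec ℕ (suc n) → ℕ} →
                   (r , f) ∈ 𝓔 → (∀ i → (n , g i) ∈ 𝓔) →
                   (n , substitute f g) ∈ 𝓔
  summation      : ∀ {r f} → (r , f) ∈ 𝓔 → (r , boundedSum f) ∈ 𝓔
  multiplication : ∀ {r f} → (r , f) ∈ 𝓔 → (r , boundedProduct f) ∈ 𝓔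
  extensional    : ∀ {n} {f g : Vec ℕ (suc n) → ℕ} → f ≗ g →
                   (n , f) ∈ 𝓔 → (n , g) ∈ 𝓔

data [2x,x-mod-y,2^x] : Pred Operation 0ℓ where
  doubling       : unary (2 *_) ∈ [2x,x-mod-y,2^x]
  modulo         : binary _mod_ ∈ [2x,x-mod-y,2^x]
  exponentiation : unary (2 ^_) ∈ [2x,x-mod-y,2^x]

{-# OPTIONS --safe #-}

-- The generators 2x and 2^x are monotone in their only argument and x mod y ≤ x,
-- so every operation in ⟨2x, x mod y, 2^x⟩ is bounded by a function of a single
-- argument. The addition is not: fixing that argument, the sum is unbounded in
-- the other one.
module Submission where

open import Data.Fin using (Fin; zero; suc)
open import Data.List using (map; upTo; _∷ʳ_; [_])
open import Data.List.Properties using (map-++; upTo-∷ʳ)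
open import Data.Nat using (ℕ; zero; suc; _+_; _*_; _∸_; _^_; _/_; _⊓_; _≤_; _≤?_; NonZero)
open import Data.Nat.DivMod using (m*n/n≡m; m/n≤m; /-monoˡ-≤; m<n*o⇒m/o<n)
open import Data.Nat.ListAction using (sum; product)
open import Data.Nat.ListAction.Properties using (sum-++; product-++)
open import Data.Nat.Properties
open import Data.Product using (_×_; _,_; ∃-syntax)
open import Data.Vec using (Vec; []; _∷_; lookup; tabulate)
open import Data.Vec.Properties using (lookup∘tabulate)
open import Function using (_∘_; id)
open import Level using (0ℓ)
open import Relation.Binary.Core using (_Preserves_⟶_)
open import Relation.Binary.PropositionalEquality
  using (_≡_; refl; sym; trans; cong; cong₂; subst; module ≡-Reasoning)
open import Relation.Nullary using (yes; no)
open import Relation.Unary using (Pred; _⊆_; _⊂_; _∈_; _∉_)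
open import Defs

-- `upTo` unfolds at the front, whereas induction on the bound of a sum has to split off the last
-- index; `upTo-∷ʳ` reconciles the two.
sum-map-upTo-suc : ∀ (f : ℕ → ℕ) n →
                   sum (map f (upTo (suc n))) ≡ sum (map f (upTo n)) + f n
sum-map-upTo-suc f n = begin
  sum (map f (upTo (suc n)))          ≡⟨ cong (sum ∘ map f) (upTo-∷ʳ n) ⟨
  sum (map f (upTo n ∷ʳ n))           ≡⟨ cong sum (map-++ f (upTo n) [ n ]) ⟩
  sum (map f (upTo n) ∷ʳ f n)         ≡⟨ sum-++ (map f (upTo n)) [ f n ] ⟩
  sum (map f (upTo n)) + (f n + 0)    ≡⟨ cong (sum (map f (upTo n)) +_) (+-identityʳ (f n)) ⟩
  sum (map f (upTo n)) + f n          ∎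
  where open ≡-Reasoning

product-map-upTo-suc : ∀ (f : ℕ → ℕ) n →
                       product (map f (upTo (suc n))) ≡ product (map f (upTo n)) * f n
product-map-upTo-suc f n = begin
  product (map f (upTo (suc n)))          ≡⟨ cong (product ∘ map f) (upTo-∷ʳ n) ⟨
  product (map f (upTo n ∷ʳ n))           ≡⟨ cong product (map-++ f (upTo n) [ n ]) ⟩
  product (map f (upTo n) ∷ʳ f n)         ≡⟨ product-++ (map f (upTo n)) [ f n ] ⟩
  product (map f (upTo n)) * (f n * 1)    ≡⟨ cong (product (map f (upTo n)) *_) (*-identityʳ (f n)) ⟩
  product (map f (upTo n)) * f n          ∎
  where open ≡-Reasoning

sum-const : ∀ c n → sum (map (λ _ → c) (upTo n)) ≡ n * c
sum-const c zero    = refl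
sum-const c (suc n) = begin
  sum (map (λ _ → c) (upTo (suc n)))  ≡⟨ sum-map-upTo-suc (λ _ → c) n ⟩
  sum (map (λ _ → c) (upTo n)) + c    ≡⟨ cong (_+ c) (sum-const c n) ⟩
  n * c + c                           ≡⟨ +-comm (n * c) c ⟩
  c + n * c                           ∎
  where open ≡-Reasoning

product-const : ∀ c n → product (map (λ _ → c) (upTo n)) ≡ c ^ n
product-const c zero    = refl
product-const c (suc n) = begin
  product (map (λ _ → c) (upTo (suc n)))  ≡⟨ product-map-upTo-suc (λ _ → c) n ⟩
  product (map (λ _ → c) (upTo n)) * c    ≡⟨ cong (_* c) (product-const c n) ⟩
  c ^ n * c                               ≡⟨ *-comm (c ^ n) c ⟩
  c * c ^ n                               ∎
  where open ≡-Reasoning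

-- 1 ∸ (suc z * d ∸ x) is the indicator of suc z * d ≤ x.
count-multiples : ∀ x d .{{_ : NonZero d}} n →
                  sum (map (λ z → 1 ∸ (suc z * d ∸ x)) (upTo n)) ≡ n ⊓ (x / d)
count-multiples x d zero    = refl
count-multiples x d (suc n) = begin
  sum (map 𝟙 (upTo (suc n)))   ≡⟨ sum-map-upTo-suc 𝟙 n ⟩
  sum (map 𝟙 (upTo n)) + 𝟙 n   ≡⟨ cong (_+ 𝟙 n) (count-multiples x d n) ⟩
  n ⊓ (x / d) + 𝟙 n            ≡⟨ step ⟩
  suc n ⊓ (x / d)              ∎
  where
  open ≡-Reasoning
  𝟙 : ℕ → ℕ
  𝟙 z = 1 ∸ (suc z * d ∸ x)
  step : n ⊓ (x / d) + 𝟙 n ≡ suc n ⊓ (x / d)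
  -- The condition is equivalent to `suc n ≤ x / d`, which is exactly when the minimum grows by one
  -- as `n` becomes `suc n`.
  step with suc n * d ≤? x
  ... | yes [1+n]d≤x = begin
    n ⊓ (x / d) + 𝟙 n   ≡⟨ cong₂ _+_ (m≤n⇒m⊓n≡m (<⇒≤ n<x/d)) (cong (1 ∸_) (m≤n⇒m∸n≡0 [1+n]d≤x)) ⟩
    n + 1               ≡⟨ +-comm n 1 ⟩
    suc n               ≡⟨ m≤n⇒m⊓n≡m n<x/d ⟨
    suc n ⊓ (x / d)     ∎
    where
    n<x/d : suc n ≤ x / d
    n<x/d = subst (_≤ x / d) (m*n/n≡m (suc n) d) (/-monoˡ-≤ d [1+n]d≤x)
  ... | no [1+n]d≰x = begin
    n ⊓ (x / d) + 𝟙 n   ≡⟨ cong₂ _+_ (m≥n⇒m⊓n≡n (m<1+n⇒m≤n x/d<1+n)) (m≤n⇒m∸n≡0 (m<n⇒0<n∸m x<[1+n]d)) ⟩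
    x / d + 0           ≡⟨ +-identityʳ (x / d) ⟩
    x / d               ≡⟨ m≥n⇒m⊓n≡n (<⇒≤ x/d<1+n) ⟨
    suc n ⊓ (x / d)     ∎
    where
    x<[1+n]d = ≰⇒> [1+n]d≰x
    x/d<1+n  = m<n*o⇒m/o<n {n = suc n} x<[1+n]d

-- Makes the quotient a bounded sum of elementary terms. The bound `x` is large enough to count all
-- positive multiples of a positive `y` up to `x`, since `x / y ≤ x`.
x-mod-y : ∀ x y → x mod y ≡ x ∸ y * sum (map (λ z → 1 ∸ (suc z * y ∸ x)) (upTo x))
-- Here the sum is `x` rather than the conventional quotient 0, but the factor `y = 0` cancels it.
x-mod-y x zero      = refl
x-mod-y x y@(suc _) = cong (λ q → x ∸ y * q) (begin
  x / y                                          ≡⟨ m≥n⇒m⊓n≡n (m/n≤m x y) ⟨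
  x ⊓ (x / y)                                    ≡⟨ count-multiples x y x ⟨
  sum (map (λ z → 1 ∸ (suc z * y ∸ x)) (upTo x)) ∎)
  where open ≡-Reasoning

compose₂ : ∀ {n} {f g : Vec ℕ (suc n) → ℕ} (_•_ : ℕ → ℕ → ℕ) → binary _•_ ∈ 𝓔 →
           (n , f) ∈ 𝓔 → (n , g) ∈ 𝓔 → (n , λ xs → f xs • g xs) ∈ 𝓔
compose₂ {f = f} {g} _ •∈𝓔 f∈𝓔 g∈𝓔 =
  substitution {g = λ { zero → f ; (suc zero) → g }} •∈𝓔 λ { zero → f∈𝓔 ; (suc zero) → g∈𝓔 }

-- The product is the sum over `z < y` of the summand `x`, the first projection of `(x , z)`.
multiplication∈𝓔 : binary _*_ ∈ 𝓔
multiplication∈𝓔 = extensional (λ { (x ∷ y ∷ []) → trans (sum-const x y) (*-comm y x) })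
  (summation (projection {1} zero))

doubling∈𝓔 : unary (2 *_) ∈ 𝓔
doubling∈𝓔 = extensional (λ { (x ∷ []) → refl })
  (compose₂ _*_ multiplication∈𝓔 (constant 2) (projection zero))

-- A bounded product of the constant `b`, with no parameters besides the bound.
exponentiation∈𝓔 : ∀ b → unary (b ^_) ∈ 𝓔
exponentiation∈𝓔 b = extensional (λ { (x ∷ []) → product-const b x })
  (multiplication (constant {0} b))

modulo∈𝓔 : binary _mod_ ∈ 𝓔
modulo∈𝓔 = extensional (λ { (x ∷ y ∷ []) → sym (x-mod-y x y) })
  (compose₂ _∸_ subtraction x∈𝓔 (compose₂ _*_ multiplication∈𝓔 y∈𝓔
    (substitution {g = λ i xs → lookup xs (xyx i)} (summation indicator∈𝓔) λ i → projection (xyx i))))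
  where
  -- The bounded sum takes `x`, `y` and a separate bound as its last argument; this reindexing sets
  -- the bound to `x`.
  xyx : Fin 3 → Fin 2
  xyx = lookup (zero ∷ suc zero ∷ zero ∷ [])
  x∈𝓔 : ∀ {n} → (n , λ xs → lookup xs zero) ∈ 𝓔
  x∈𝓔 = projection zero
  y∈𝓔 : ∀ {n} → (suc n , λ xs → lookup xs (suc zero)) ∈ 𝓔
  y∈𝓔 = projection (suc zero)
  z∈𝓔 : (2 , λ xs → lookup xs (suc (suc zero))) ∈ 𝓔
  z∈𝓔 = projection (suc (suc zero))
  indicator : ℕ → ℕ → ℕ → ℕ
  indicator x y z = 1 ∸ (suc z * y ∸ x)
  indicator∈𝓔 : (2 , λ xs → indicator (lookup xs zero) (lookup xs (suc zero)) (lookup xs (suc (suc zero)))) ∈ 𝓔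
  indicator∈𝓔 =
    compose₂ _∸_ subtraction (constant 1)
      (compose₂ _∸_ subtraction
        -- The successor is built as `1 + z`, which reduces to `suc z`.
        (compose₂ _*_ multiplication∈𝓔 (compose₂ _+_ addition (constant 1) z∈𝓔) y∈𝓔)
        x∈𝓔)

⟨2x,x-mod-y,2^x⟩⊆𝓔 : ⟨ [2x,x-mod-y,2^x] ⟩ ⊆ 𝓔
⟨2x,x-mod-y,2^x⟩⊆𝓔 (base doubling)       = doubling∈𝓔
⟨2x,x-mod-y,2^x⟩⊆𝓔 (base modulo)         = modulo∈𝓔
⟨2x,x-mod-y,2^x⟩⊆𝓔 (base exponentiation) = exponentiation∈𝓔 2
⟨2x,x-mod-y,2^x⟩⊆𝓔 (constant c)          = constant c
⟨2x,x-mod-y,2^x⟩⊆𝓔 (projection i)        = projection i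
⟨2x,x-mod-y,2^x⟩⊆𝓔 (substitution f g)    =
  substitution (⟨2x,x-mod-y,2^x⟩⊆𝓔 f) λ i → ⟨2x,x-mod-y,2^x⟩⊆𝓔 (g i)
⟨2x,x-mod-y,2^x⟩⊆𝓔 (extensional f≗g f)   = extensional f≗g (⟨2x,x-mod-y,2^x⟩⊆𝓔 f)

-- Monotonicity of the bound is what makes this property stable under substitution.
BoundedByOneArgument : Pred Operation 0ℓ
BoundedByOneArgument (n , f) =
  ∃[ i ] ∃[ h ] h Preserves _≤_ ⟶ _≤_ × (∀ xs → f xs ≤ h (lookup xs i))

boundedByOneArgument : ⟨ [2x,x-mod-y,2^x] ⟩ ⊆ BoundedByOneArgument
boundedByOneArgument (base doubling) =
  zero , (2 *_) , *-monoʳ-≤ 2 , λ { (x ∷ []) → ≤-refl }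
-- The dividend bounds the result, also for `y = 0`, where `x mod 0` is `x`.
boundedByOneArgument (base modulo) =
  zero , id , id , λ { (x ∷ y ∷ []) → m∸n≤m x (y * ⌊ x ÷ y ⌋) }
boundedByOneArgument (base exponentiation) =
  zero , (2 ^_) , ^-monoʳ-≤ 2 , λ { (x ∷ []) → ≤-refl }
boundedByOneArgument (constant c)   = zero , (λ _ → c) , (λ _ → ≤-refl) , λ _ → ≤-refl
boundedByOneArgument (projection i) = i , id , id , λ _ → ≤-refl
boundedByOneArgument (substitution {f = f} {g} f∈ g∈) with boundedByOneArgument f∈
... | i , h , h-mono , f≤h with boundedByOneArgument (g∈ i)
-- Only the inner operation `g i` in the controlling position `i` of `f` matters; its own
-- controlling argument `j` then controls the composite.
... | j , k , k-mono , g≤k = j , h ∘ k , h-mono ∘ k-mono , λ xs → begin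
  f (tabulate λ i → g i xs)            ≤⟨ f≤h (tabulate λ i → g i xs) ⟩
  h (lookup (tabulate λ i → g i xs) i) ≡⟨ cong h (lookup∘tabulate (λ i → g i xs) i) ⟩
  h (g i xs)                           ≤⟨ h-mono (g≤k xs) ⟩
  h (k (lookup xs j))                  ∎
  where open ≤-Reasoning
boundedByOneArgument (extensional f≗g f∈) with boundedByOneArgument f∈
... | i , h , h-mono , f≤h = i , h , h-mono , λ xs → ≤-trans (≤-reflexive (sym (f≗g xs))) (f≤h xs)

addition-notBoundedByOneArgument : binary _+_ ∉ BoundedByOneArgument
addition-notBoundedByOneArgument (zero , h , _ , +≤h) =
  -- With the controlling argument 0, the other is chosen one above the supposed bound `h 0`.
  1+n≰n (+≤h (0 ∷ suc (h 0) ∷ []))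
addition-notBoundedByOneArgument (suc zero , h , _ , +≤h) =
  1+n≰n (≤-trans (m≤m+n (suc (h 0)) 0) (+≤h (suc (h 0) ∷ 0 ∷ [])))

theorem12 : ⟨ [2x,x-mod-y,2^x] ⟩ ⊂ 𝓔
theorem12 = ⟨2x,x-mod-y,2^x⟩⊆𝓔 , λ 𝓔⊆⟨2x,x-mod-y,2^x⟩ →
  addition-notBoundedByOneArgument (boundedByOneArgument (𝓔⊆⟨2x,x-mod-y,2^x⟩ addition))
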